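{- The language $\mathbf{DELKh}$ is equally expressive as its fragment $\mathbf{EL}$ over models: for every $\varphi\in\mathbf{DELKh}$ there is $\psi\in\mathbf{EL}$ such that for every model $M$ and every world $w$ of $M$, $M,w\vDash\varphi$ if and only if $M,w\vDash\psi$ (and, conversely, every $\mathbf{EL}$-formula is equivalent in this sense to a $\mathbf{DELKh}$-formula).
   Context: Fix a countable set $\mathbf{P}$ of proposition letters. $\mathbf{PL}$: $\alpha::=p\mid\bot\mid(\alpha\land\alpha)\mid(\alpha\lor\alpha)\mid(\alpha\to\alpha)$, $p\in\mathbf{P}$. $\mathbf{DELKh}$: $\varphi::=p\mid\bot\mid(\varphi\land\varphi)\mid(\varphi\lor\varphi)\mid(\varphi\to\varphi)\mid\mathsf{K}\varphi\mid\mathsf{Kh}\alpha\mid\Box\varphi$, with $p\in\mathbf{P}$, $\alpha\in\mathbf{PL}$. $\mathbf{EL}$ is the fragment of $\mathbf{DELKh}$ consisting of formulas containing neither $\mathsf{Kh}$ nor $\Box$. A model (epistemic model) is $M=\langle W,V\rangle$ with $W\ne\varnothing$ and $V:W\to\wp(\mathbf{P})$. A submodel of $M$ is $\langle W',V|_{W'}\rangle$ with $\varnothing\ne W'\subseteq W$. Resolution space: $S(p)=\{p\}$; $S(\bot)=\{\bot\}$; $S(\alpha\lor\beta)=(S(\alpha)\times\{0\})\cup(S(\beta)\times\{1\})$; $S(\alpha\land\beta)=S(\alpha)\times S(\beta)$; $S(\alpha\to\beta)=S(\beta)^{S(\alpha)}$. Resolutions at $w\in W$: $R(w,\bot)=\varnothing$;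 $R(w,p)=\{p\}$ if $p\in V(w)$, else $\varnothing$; $R(w,\alpha\lor\beta)=(R(w,\alpha)\times\{0\})\cup(R(w,\beta)\times\{1\})$; $R(w,\alpha\land\beta)=R(w,\alpha)\times R(w,\beta)$; $R(w,\alpha\to\beta)=\{f\in S(\beta)^{S(\alpha)}\mid f[R(w,\alpha)]\subseteq R(w,\beta)\}$. Satisfaction $M,w\vDash\varphi$: $M,w\nvDash\bot$; $M,w\vDash p$ iff $p\in V(w)$; $\land,\lor,\to$ are classical; $M,w\vDash\Box\varphi$ iff $M',w\vDash\varphi$ for every submodel $M'$ of $M$ containing $w$; $M,w\vDash\mathsf{K}\varphi$ iff $M,v\vDash\varphi$ for all $v\in W$; $M,w\vDash\mathsf{Kh}\alpha$ iff there is $x\in S(\alpha)$ with $x\in R(v,\alpha)$ for all $v\in W$. -}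

module Defs where

open import Data.Empty.Polymorphic using (⊥)
open import Data.Irrelevant using ([_])
open import Data.Product using (Σ-syntax; _×_; _,_)
open import Data.Refinement using (Refinement; _,_; value)
open import Data.Sum using (_⊎_)
open import Data.Unit using (⊤)
open import Function.Base using (_∘_)
open import Level using (Level; Lift; suc)
open import Relation.Unary using (Pred; Satisfiable; _∈_; _⟨×⟩_; _⟨⊎⟩_; _⟨→⟩_)

infixr 7 _`∧_
infixr 6 _`∨_
infixr 5 _`→_
infix 8 `K_ `Kh_ `□_
infix 4 _,_⊨_

data PL (P : Set) : Set where
  `_             : P → PL P
  `⊥             : PL P
  _`∧_ _`∨_ _`→_ : (α β : PL P) → PL P

data DELKh (P : Set) : Set where
  `_             : P → DELKh P
  `⊥             : DELKh P
  _`∧_ _`∨_ _`→_ : (φ ψ : DELKh P) → DELKh P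
  `K_            : DELKh P → DELKh P
  `Kh_           : PL P → DELKh P
  `□_            : DELKh P → DELKh P

data EL {P : Set} : DELKh P → Set where
  `_   : ∀ p → EL (` p)
  `⊥   : EL `⊥
  _`∧_ : ∀ {φ ψ} → EL φ → EL ψ → EL (φ `∧ ψ)
  _`∨_ : ∀ {φ ψ} → EL φ → EL ψ → EL (φ `∨ ψ)
  _`→_ : ∀ {φ ψ} → EL φ → EL ψ → EL (φ `→ ψ)
  `K_  : ∀ {φ} → EL φ → EL (`K φ)

record Model (P : Set) (ℓ : Level) : Set (suc ℓ) where
  field
    World    : Set ℓ
    nonempty : World
    V        : World → Pred P ℓ

open Model

record Submodel {P : Set} {ℓ : Level} (M : Model P ℓ) : Set (suc ℓ) where
  field
    worlds   : Pred (World M) ℓ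
    nonempty : Satisfiable worlds

open Submodel using (worlds)

-- Membership proofs are irrelevant in a Refinement, so that each world of M
-- occurs at most once in the submodel.
⟦_⟧ : ∀ {P ℓ} {M : Model P ℓ} → Submodel M → Model P ℓ
⟦_⟧ {M = M} N = record
  { World    = Refinement (World M) (worlds N)
  ; nonempty = let w , w∈N = Submodel.nonempty N in w , [ w∈N ]
  ; V        = V M ∘ value
  }

-- The singletons {p} and {⊥} are both rendered as ⊤; the tags 0 and 1 of a
-- disjunction are the injections of _⊎_.
S : ∀ {P} → PL P → Set
S (` p)    = ⊤
S `⊥       = ⊤
S (α `∧ β) = S α × S β
S (α `∨ β) = S α ⊎ S β
S (α `→ β) = S α → S β

R : ∀ {P ℓ} (M : Model P ℓ) → World M → (α : PL P) → Pred (S α) ℓ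
R M w (` p)    = λ _ → p ∈ V M w
R M w `⊥       = λ _ → ⊥
R M w (α `∧ β) = R M w α ⟨×⟩ R M w β
R M w (α `∨ β) = R M w α ⟨⊎⟩ R M w β
R M w (α `→ β) = R M w α ⟨→⟩ R M w β

-- To be read classically: under excluded middle, _⊎_, _→_ and Σ are the
-- classical connectives the semantics calls for. The clause for □ quantifies
-- over subsets of the worlds, hence the universe.
_,_⊨_ : ∀ {P ℓ} (M : Model P ℓ) → World M → DELKh P → Set (suc ℓ)
_,_⊨_ {ℓ = ℓ} M w (` p) = Lift (suc ℓ) (p ∈ V M w)
M , w ⊨ `⊥       = ⊥
M , w ⊨ (φ `∧ ψ) = (M , w ⊨ φ) × (M , w ⊨ ψ)
M , w ⊨ (φ `∨ ψ) = (M , w ⊨ φ) ⊎ (M , w ⊨ ψ)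
M , w ⊨ (φ `→ ψ) = M , w ⊨ φ → M , w ⊨ ψ
M , w ⊨ (`K φ)   = ∀ v → M , v ⊨ φ
_,_⊨_ {ℓ = ℓ} M w (`Kh α) =
  Lift (suc ℓ) (Σ[ x ∈ S α ] (∀ v → x ∈ R M v α))
M , w ⊨ (`□ φ)   =
  ∀ (N : Submodel M) (w∈N : w ∈ worlds N) → ⟦ N ⟧ , (w , [ w∈N ]) ⊨ φ

{-# OPTIONS --safe #-}

-- Let Q be the finite list of letters of φ. Whether M , w ⊨ φ holds depends
-- only on the valuation of w on Q and on the set of valuations on Q realised
-- in M: models realising the same valuations have submodels realising the
-- same valuations, and a resolution that works at a world works at every world
-- with the same valuation on Q. This finite amount of information about (M , w)
-- is recorded by the truth values of finitely many EL-formulas, so φ is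
-- equivalent to the disjunction of those complete descriptions of these truth
-- values which are consistent with φ.
module Submission where

open import Defs
open import Axiom.ExcludedMiddle using (ExcludedMiddle)
open import Data.Empty.Polymorphic using (⊥-elim)
open import Data.Irrelevant using ([_])
open import Data.List.Base using (List; []; _∷_; _++_; map; filter; foldr)
open import Data.List.Membership.Propositional using (_∈_; find; lose)
open import Data.List.Membership.Propositional.Properties
  using (∈-++⁺ˡ; ∈-++⁺ʳ; ∈-++⁻; ∈-map⁺; ∈-map⁻; ∈-filter⁺; ∈-filter⁻)
open import Data.List.Relation.Binary.Subset.Propositional using (_⊆_)
open import Data.List.Relation.Unary.Any using (Any; here; there)
open import Data.Nat using (ℕ)
open import Data.Product using (Σ; Σ-syntax; ∃; _×_; _,_; proj₁; proj₂; swap)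
import Data.Product as Product
open import Data.Refinement using (_,_)
open import Data.Sum using (inj₁; inj₂)
import Data.Sum as Sum
open import Function.Base using (id; _∘_)
open import Function.Bundles using (_↣_; _⇔_; mk⇔; Equivalence)
open import Function.Construct.Identity using (⇔-id)
open import Function.Construct.Symmetry using (⇔-sym)
open import Level using (Level; Lift; lift; lower; suc)
open import Relation.Binary.PropositionalEquality using (refl)
open import Relation.Nullary using (Dec; yes; no; ¬_; contradiction)
open import Relation.Nullary.Decidable using (map′; decidable-stable; recompute)

open Equivalence using (to; from)
open Model using (World; V)
open Submodel using (worlds)

private
  variable
    ℓ : Level
    P : Set
    Q : List P
    M M′ : Model P ℓ

lettersPL : PL P → List P
lettersPL (` p)    = p ∷ []
lettersPL `⊥       = []
lettersPL (α `∧ β) = lettersPL α ++ lettersPL β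
lettersPL (α `∨ β) = lettersPL α ++ lettersPL β
lettersPL (α `→ β) = lettersPL α ++ lettersPL β

letters : DELKh P → List P
letters (` p)    = p ∷ []
letters `⊥       = []
letters (φ `∧ ψ) = letters φ ++ letters ψ
letters (φ `∨ ψ) = letters φ ++ letters ψ
letters (φ `→ ψ) = letters φ ++ letters ψ
letters (`K φ)   = letters φ
letters (`Kh α)  = lettersPL α
letters (`□ φ)   = letters φ

AgreeOn : List P → (M : Model P ℓ) → World M → (M′ : Model P ℓ) → World M′ → Set ℓ
AgreeOn Q M w M′ w′ = ∀ {p} → p ∈ Q → V M w p ⇔ V M′ w′ p

agreeOn-sym : ∀ {w w′} → AgreeOn Q M w M′ w′ → AgreeOn Q M′ w′ M w
agreeOn-sym w≈w′ p∈Q = ⇔-sym (w≈w′ p∈Q)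

-- `S α` does not depend on the model, so the same `x` can be tested on both sides. An equivalence
-- is needed for the induction: in the case of `→` arguments travel backwards before results travel
-- forwards.
R-invariant : ∀ (M M′ : Model P ℓ) α {w w′} → lettersPL α ⊆ Q → AgreeOn Q M w M′ w′ →
              ∀ x → R M w α x ⇔ R M′ w′ α x
R-invariant M M′ (` p)    α⊆Q w≈w′ x = w≈w′ (α⊆Q (here refl))
R-invariant M M′ `⊥       α⊆Q w≈w′ x = ⇔-id _
R-invariant M M′ (α `∧ β) α⊆Q w≈w′ (x , y) =
  mk⇔ (Product.map (to ih₁) (to ih₂)) (Product.map (from ih₁) (from ih₂))
  where
  ih₁ = R-invariant M M′ α (α⊆Q ∘ ∈-++⁺ˡ) w≈w′ x
  ih₂ = R-invariant M M′ β (α⊆Q ∘ ∈-++⁺ʳ (lettersPL α)) w≈w′ y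
R-invariant M M′ (α `∨ β) α⊆Q w≈w′ (inj₁ x) =
  R-invariant M M′ α (α⊆Q ∘ ∈-++⁺ˡ) w≈w′ x
R-invariant M M′ (α `∨ β) α⊆Q w≈w′ (inj₂ y) =
  R-invariant M M′ β (α⊆Q ∘ ∈-++⁺ʳ (lettersPL α)) w≈w′ y
R-invariant M M′ (α `→ β) α⊆Q w≈w′ f =
  mk⇔ (λ h {x} r → to (ih₂ (f x)) (h (from (ih₁ x) r)))
      (λ h {x} r → from (ih₂ (f x)) (h (to (ih₁ x) r)))
  where
  ih₁ = R-invariant M M′ α (α⊆Q ∘ ∈-++⁺ˡ) w≈w′
  ih₂ = R-invariant M M′ β (α⊆Q ∘ ∈-++⁺ʳ (lettersPL α)) w≈w′

-- As `K` ranges over all worlds, a bisimulation needs no accessibility clause. The second half is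
-- the first with the models exchanged, so that `swap` gives symmetry.
Bisimilar : List P → Model P ℓ → Model P ℓ → Set ℓ
Bisimilar Q M M′ = (∀ v → ∃ λ v′ → AgreeOn Q M v M′ v′)
                 × (∀ v′ → ∃ λ v → AgreeOn Q M′ v′ M v)

module _ (em : ExcludedMiddle (suc ℓ)) where

  decide : (A : Set ℓ) → Dec A
  decide A = map′ lower lift (em {P = Lift (suc ℓ) A})

  -- One direction suffices because the hypotheses are symmetric; the case of `→` uses the exchanged
  -- instance. The models vary in the induction, since `□` passes to submodels.
  ⊨-invariant : ∀ {M M′ : Model P ℓ} φ {w w′} → letters φ ⊆ Q →
                Bisimilar Q M M′ → AgreeOn Q M w M′ w′ →
                M , w ⊨ φ → M′ , w′ ⊨ φ
  ⊨-invariant (` p) φ⊆Q _ w≈w′ (lift h) = lift (to (w≈w′ (φ⊆Q (here refl))) h)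
  ⊨-invariant (φ `∧ ψ) φ⊆Q M≈M′ w≈w′ =
    Product.map (⊨-invariant φ (φ⊆Q ∘ ∈-++⁺ˡ) M≈M′ w≈w′)
                (⊨-invariant ψ (φ⊆Q ∘ ∈-++⁺ʳ (letters φ)) M≈M′ w≈w′)
  ⊨-invariant (φ `∨ ψ) φ⊆Q M≈M′ w≈w′ =
    Sum.map (⊨-invariant φ (φ⊆Q ∘ ∈-++⁺ˡ) M≈M′ w≈w′)
            (⊨-invariant ψ (φ⊆Q ∘ ∈-++⁺ʳ (letters φ)) M≈M′ w≈w′)
  ⊨-invariant {M = M} {M′} (φ `→ ψ) φ⊆Q M≈M′ w≈w′ h =
    ⊨-invariant ψ (φ⊆Q ∘ ∈-++⁺ʳ (letters φ)) M≈M′ w≈w′ ∘ h ∘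
    ⊨-invariant φ (φ⊆Q ∘ ∈-++⁺ˡ) (swap M≈M′) (agreeOn-sym {M = M} {M′ = M′} w≈w′)
  ⊨-invariant {M = M} {M′} (`K φ) φ⊆Q M≈M′ _ h v′ =
    let v , v′≈v = proj₂ M≈M′ v′
    in ⊨-invariant φ φ⊆Q M≈M′ (agreeOn-sym {M = M′} {M′ = M} v′≈v) (h v)
  ⊨-invariant {M = M} {M′} (`Kh α) φ⊆Q M≈M′ _ (lift (x , h)) = lift (x , λ v′ →
    let v , v′≈v = proj₂ M≈M′ v′
    in from (R-invariant M′ M α φ⊆Q v′≈v x) (h v))
  ⊨-invariant {P = P} {Q = Q} {M = M} {M′} (`□ φ) {w} {w′} φ⊆Q M≈M′ w≈w′ h N′ w′∈N′ =
    ⊨-invariant φ φ⊆Q (forth , back) w≈w′ (h N (w′ , w′∈N′ , w≈w′))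
    where
    -- The worlds of `M` that agree with some world of `N′`; `w` is one of them because of `w′`.
    N : Submodel M
    N = record
      { worlds   = λ v → Σ[ v′ ∈ World M′ ] (worlds N′ v′ × AgreeOn Q M v M′ v′)
      ; nonempty = w , w′ , w′∈N′ , w≈w′
      }

    forth : ∀ v → ∃ λ v′ → AgreeOn Q ⟦ N ⟧ v ⟦ N′ ⟧ v′
    forth (v , [ v∈N ]) =
      -- The partner `v′` is hidden in an irrelevant membership proof; decidability of membership,
      -- by excluded middle, recovers it.
      let v′ , v′∈N′ , v≈v′ = recompute (decide (worlds N v)) v∈N
      in (v′ , [ v′∈N′ ]) , v≈v′

    back : ∀ v′ → ∃ λ v → AgreeOn Q ⟦ N′ ⟧ v′ ⟦ N ⟧ v
    back (v′ , [ v′∈N′ ]) =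
      -- The partner comes from `M≈M′`, and `v′` itself witnesses that it lies in `N`. The proof
      -- `v′∈N′` is used only irrelevantly, so nothing is recomputed.
      let v , v′≈v = proj₂ M≈M′ v′
      in (v , [ v′ , v′∈N′ , agreeOn-sym {M = M′} {M′ = M} v′≈v ]) , v′≈v

ELFormula : Set → Set
ELFormula P = Σ (DELKh P) EL

infix 4 _⊩_

_⊩_ : Σ (Model P ℓ) World → ELFormula P → Set (suc ℓ)
(M , w) ⊩ (ψ , _) = M , w ⊨ ψ

letter : P → ELFormula P
letter p = ` p , ` p

`false `true : ELFormula P
`false = `⊥ , `⊥
`true  = `⊥ `→ `⊥ , `⊥ `→ `⊥

infixr 7 _and_
infixr 6 _or_

_and_ _or_ : (d e : ELFormula P) → ELFormula P
(φ , a) and (ψ , b) = φ `∧ ψ , a `∧ b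
(φ , a) or  (ψ , b) = φ `∨ ψ , a `∨ b

negate nowhere : ELFormula P → ELFormula P
negate (φ , a) = φ `→ `⊥ , a `→ `⊥
nowhere d = let φ , a = negate d in `K φ , `K a

⋁ : List (ELFormula P) → ELFormula P
⋁ = foldr _or_ `false

⋁⁺ : ∀ {x : Σ (Model P ℓ) World} {ds} → Any (x ⊩_) ds → x ⊩ ⋁ ds
⋁⁺ (here h)  = inj₁ h
⋁⁺ (there h) = inj₂ (⋁⁺ h)

⋁⁻ : ∀ {x : Σ (Model P ℓ) World} ds → x ⊩ ⋁ ds → Any (x ⊩_) ds
⋁⁻ (d ∷ ds) (inj₁ h) = here h
⋁⁻ (d ∷ ds) (inj₂ h) = there (⋁⁻ ds h)

-- The state descriptions over the list: every entry occurs as a conjunct, plain or negated.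
descriptions : List (ELFormula P) → List (ELFormula P)
descriptions []      = `true ∷ []
descriptions (e ∷ F) = map (e and_) (descriptions F) ++ map (negate e and_) (descriptions F)

descriptions-exhaustive : ExcludedMiddle (suc ℓ) → (x : Σ (Model P ℓ) World) → ∀ F →
                          Σ[ d ∈ ELFormula P ] (d ∈ descriptions F × x ⊩ d)
descriptions-exhaustive em x []      = `true , here refl , id
descriptions-exhaustive em x (e ∷ F)
  with em {P = x ⊩ e} | descriptions-exhaustive em x F
... | yes h | d , d∈ , x⊩d = e and d , ∈-++⁺ˡ (∈-map⁺ _ d∈) , h , x⊩d
... | no ¬h | d , d∈ , x⊩d =
  negate e and d , ∈-++⁺ʳ (map (e and_) (descriptions F)) (∈-map⁺ _ d∈) ,
  (λ h → contradiction h ¬h) , x⊩d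

-- Either `e` is itself a conjunct of `d`, hence true at `y`, or its negation is, which contradicts
-- `x ⊩ e`.
descriptions-complete : ∀ {x y : Σ (Model P ℓ) World} {d} F → d ∈ descriptions F →
                        x ⊩ d → y ⊩ d → ∀ {e} → e ∈ F → x ⊩ e → y ⊩ e
descriptions-complete (e ∷ F) d∈ x⊩d y⊩d e∈ x⊩e
  with ∈-++⁻ (map (e and_) (descriptions F)) d∈
descriptions-complete (e ∷ F) _ x⊩d y⊩d e∈ x⊩e | inj₁ d∈
  with ∈-map⁻ (e and_) d∈ | e∈
... | d , _ , refl | here refl = proj₁ y⊩d
... | d , d∈F , refl | there e∈F =
  descriptions-complete F d∈F (proj₂ x⊩d) (proj₂ y⊩d) e∈F x⊩e
descriptions-complete (e ∷ F) _ x⊩d y⊩d e∈ x⊩e | inj₂ d∈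
  with ∈-map⁻ (negate e and_) d∈ | e∈
... | d , _ , refl | here refl = ⊥-elim (proj₁ x⊩d x⊩e)
... | d , d∈F , refl | there e∈F =
  descriptions-complete F d∈F (proj₂ x⊩d) (proj₂ y⊩d) e∈F x⊩e

-- The letters fix the valuation of the current world; the formulas `nowhere d` fix which valuations
-- on `Q` are realised in the model.
separating : List P → List (ELFormula P)
separating Q = map letter Q ++ map nowhere (descriptions (map letter Q))

module _ (em : ExcludedMiddle (suc ℓ)) {P : Set} where

  stable : {A : Set (suc ℓ)} → ¬ ¬ A → A
  stable = decidable-stable em

  description⇒agreeOn : ∀ {M M′ : Model P ℓ} {w w′} Q {d} → d ∈ descriptions (map letter Q) →
                        (M , w) ⊩ d → (M′ , w′) ⊩ d → AgreeOn Q M w M′ w′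
  description⇒agreeOn Q d∈ h h′ p∈Q = mk⇔
    (λ k → lower (descriptions-complete _ d∈ h h′ (∈-map⁺ letter p∈Q) (lift k)))
    (λ k → lower (descriptions-complete _ d∈ h′ h (∈-map⁺ letter p∈Q) (lift k)))

  -- Let `d` describe the valuation of `v`. If no world of `M′` matched `v`, then `nowhere d` would
  -- hold in `M′`, hence in `M`, where `v` refutes it.
  agree⇒forth : ∀ {M M′ : Model P ℓ} {w w′} Q →
                (∀ {e} → e ∈ separating Q → (M′ , w′) ⊩ e → (M , w) ⊩ e) →
                ∀ v → ∃ λ v′ → AgreeOn Q M v M′ v′
  agree⇒forth {M} {M′} Q transfer v =
    let d , d∈ , v⊩d = descriptions-exhaustive em (M , v) (map letter Q)
        nowhere-d∈   = ∈-++⁺ʳ (map letter Q) (∈-map⁺ nowhere d∈)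
        lift (v′ , v≈v′) = stable {A = Lift (suc ℓ) (∃ λ v′ → AgreeOn Q M v M′ v′)} λ ¬∃ →
          ⊥-elim (transfer nowhere-d∈
            (λ v′ v′⊩d → contradiction (lift (v′ , description⇒agreeOn Q d∈ v⊩d v′⊩d)) ¬∃)
            v v⊩d)
    in v′ , v≈v′

  separating-determines : ∀ φ {M M′ : Model P ℓ} {w w′} →
    let F = separating (letters φ) in
    (∀ {e} → e ∈ F → (M , w) ⊩ e → (M′ , w′) ⊩ e) →
    (∀ {e} → e ∈ F → (M′ , w′) ⊩ e → (M , w) ⊩ e) →
    M , w ⊨ φ → M′ , w′ ⊨ φ
  separating-determines φ {M} {M′} to-M′ to-M =
    ⊨-invariant em φ id (agree⇒forth (letters φ) to-M , agree⇒forth (letters φ) to-M′)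
      λ p∈Q → mk⇔ (lower ∘ to-M′ (∈-++⁺ˡ (∈-map⁺ letter p∈Q)) ∘ lift)
                  (lower ∘ to-M  (∈-++⁺ˡ (∈-map⁺ letter p∈Q)) ∘ lift)

  -- Quantifying over all models of level `ℓ` keeps `normalForm` independent of the model at hand.
  -- Excluded middle decides this existence statement, so the choice of disjuncts is not
  -- constructive.
  ConsistentWith : DELKh P → ELFormula P → Set (suc ℓ)
  ConsistentWith φ d = Σ[ M ∈ Model P ℓ ] Σ[ w ∈ World M ] ((M , w) ⊩ d × M , w ⊨ φ)

  normalForm : DELKh P → ELFormula P
  normalForm φ =
    ⋁ (filter (λ d → em {P = ConsistentWith φ d}) (descriptions (separating (letters φ))))

  normalForm-correct : ∀ φ (M : Model P ℓ) w → (M , w ⊨ φ) ⇔ ((M , w) ⊩ normalForm φ)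
  normalForm-correct φ M w = mk⇔ ⇒ ⇐
    where
    F = separating (letters φ)
    consistent? = λ d → em {P = ConsistentWith φ d}

    ⇒ : M , w ⊨ φ → (M , w) ⊩ normalForm φ
    ⇒ h = let d , d∈ , w⊩d = descriptions-exhaustive em (M , w) F
          in ⋁⁺ (lose (∈-filter⁺ consistent? d∈ (M , w , w⊩d , h)) w⊩d)

    ⇐ : (M , w) ⊩ normalForm φ → M , w ⊨ φ
    -- The disjunct true at `w` survived the filter, so some `(M′ , w′)` satisfies both it and `φ`;
    -- sharing `d` lets `φ` pass from there to `(M , w)`.
    ⇐ h = let d , d∈filter , w⊩d         = find (⋁⁻ (filter consistent? (descriptions F)) h)
              d∈ , M′ , w′ , w′⊩d , w′⊨φ = ∈-filter⁻ consistent? d∈filter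
          in separating-determines φ (descriptions-complete F d∈ w′⊩d w⊩d)
                                     (descriptions-complete F d∈ w⊩d w′⊩d) w′⊨φ

theorem41 : ∀ {ℓ} {P : Set} → P ↣ ℕ → ExcludedMiddle (suc ℓ) →
    (∀ (φ : DELKh P) → Σ[ ψ ∈ DELKh P ] (EL ψ ×
    (∀ (M : Model P ℓ) (w : Model.World M) → (M , w ⊨ φ) ⇔ (M , w ⊨ ψ))))
    ×
    (∀ (ψ : DELKh P) → EL ψ → Σ[ φ ∈ DELKh P ]
    (∀ (M : Model P ℓ) (w : Model.World M) → (M , w ⊨ ψ) ⇔ (M , w ⊨ φ)))
theorem41 _ em =
  (λ φ → let ψ , EL-ψ = normalForm em φ in ψ , EL-ψ , normalForm-correct em φ) ,
  (λ ψ _ → ψ , λ _ _ → ⇔-id _)
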